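{- Let $k\geq 2$ and let $D_1, D_2, \ldots, D_k$ be a collection of pairwise vertex disjoint Hamiltonian digraphs, let $n_i=|V(D_i)|$ for each $i\in\{1,\ldots,k\}$, and let $D$ be a strongly connected digraph in $\oplus_{i=1}^k D_i$. Then at least one of the following assertions holds: (i) $D$ is vertex-pancyclic; (ii) $D$ is pancyclic; or (iii) $D$ is Hamiltonian and it contains a cycle of length $l$ for each integer $l$ with $3\leq l\leq \max\left\{\left(\sum_{i\in S} n_i\right) + 1 \colon S\subset\{1,\ldots,k\},\ |S|=k-1\right\}$.
   Context: Digraphs are finite, without loops or parallel arcs; a pair of opposite arcs $(u,v),(v,u)$ is allowed and forms a cycle of length 2. "Cycle" means directed cycle (no repeated vertices), and its length is its number of arcs. A digraph is Hamiltonian if it has a cycle containing all its vertices. A digraph is strong (strongly connected) if for each pair of different vertices $u,v$ there exist a directed path from $u$ to $v$ and one from $v$ to $u$. A digraph $D$ of order $N\geq 3$ is pancyclic if it contains a cycle of length $l$ for each $l\in\{3,\ldots,N\}$. It is vertex-pancyclic if for each vertex $v$ and each $l\in\{3,\ldots,N\}$ it contains a cycle of length $l$ passing through $v$. Generalized sum: for pairwise vertex disjoint digraphs $D_1,\ldots,D_k$, the set $\oplus_{i=1}^k D_i$ consists of all digraphs $D$ such that (1) $V(D)=\bigcup_{i=1}^k V(D_i)$; (2) for each $i$ the subdigraph of $D$ induced by $V(D_i)$ is $D_i$; (3) for each pair of vertices $u,v$ belonging to different summands, exactly one of $(u,v)$, $(v,u)$ is an arc of $D$ (directions being arbitrary).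 -}

module Defs where

open import Data.Bool using (if_then_else_)
open import Data.Fin using (Fin)
open import Data.Fin.Subset using (Subset)
open import Data.List using (List; _∷_; _∷ʳ_; length)
open import Data.List.Membership.Propositional using (_∈_)
open import Data.List.Relation.Unary.Linked using (Linked)
open import Data.List.Relation.Unary.Unique.Propositional using (Unique)
open import Data.Nat using (ℕ; _≤_)
open import Data.Product using (_×_; _,_; ∃-syntax)
open import Data.Sum using (_⊎_)
open import Data.Vec using (lookup; sum; tabulate)
open import Function.Bundles using (_↔_; _⇔_; Inverse)
open import Level using (0ℓ)
open import Relation.Binary using (Rel; Decidable; Irreflexive)
open import Relation.Binary.PropositionalEquality using (_≡_; _≢_)
open import Relation.Nullary using (¬_)

-- Arcs form a relation, so there are no parallel arcs; opposite arcs are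
-- allowed.  Decidability of the relation is part of being a finite digraph.
record Digraph : Set₁ where
  field
    order    : ℕ
    Arc      : Rel (Fin order) 0ℓ
    arc?     : Decidable Arc
    loopless : Irreflexive _≡_ Arc

  Vertex : Set
  Vertex = Fin order

open Digraph public using (order; Vertex)

module _ (D : Digraph) where
  open Digraph D using (Arc)

  -- The interior vertices are listed, so u and v are necessarily distinct.
  record Path (u v : Vertex D) : Set where
    field
      interior : List (Vertex D)
      distinct : Unique (u ∷ interior ∷ʳ v)
      arcs     : Linked Arc (u ∷ interior ∷ʳ v)

  Strong : Set
  Strong = ∀ (u v : Vertex D) → u ≢ v → Path u v × Path v u

  -- The length is at least 2, since a single vertex would need a loop.
  record Cycle : Set where
    field
      start    : Vertex D
      rest     : List (Vertex D)
      distinct : Unique (start ∷ rest)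
      arcs     : Linked Arc (start ∷ rest ∷ʳ start)

    vertices : List (Vertex D)
    vertices = start ∷ rest

    cycleLength : ℕ
    cycleLength = length vertices

  open Cycle

  Hamiltonian : Set
  Hamiltonian = ∃[ c ] ∀ (v : Vertex D) → v ∈ vertices c

  HasCycleOfLength : ℕ → Set
  HasCycleOfLength l = ∃[ c ] cycleLength c ≡ l

  Pancyclic : Set
  Pancyclic = 3 ≤ order D ×
    (∀ l → 3 ≤ l → l ≤ order D → HasCycleOfLength l)

  VertexPancyclic : Set
  VertexPancyclic = 3 ≤ order D ×
    (∀ (v : Vertex D) l → 3 ≤ l → l ≤ order D →
      ∃[ c ] cycleLength c ≡ l × v ∈ vertices c)

ExactlyOne : Set → Set → Set
ExactlyOne A B = (A × ¬ B) ⊎ (¬ A × B)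

-- Disjointness of the summands is expressed by the disjoint union
-- ∃[ i ] Vertex (Ds i); the bijection identifies it with the vertex set of D.
record _∈⊕_ (D : Digraph) {k : ℕ} (Ds : Fin k → Digraph) : Set where
  field
    union : (∃[ i ] Vertex (Ds i)) ↔ Vertex D

  embed : ∀ i → Vertex (Ds i) → Vertex D
  embed i u = Inverse.to union (i , u)

  field
    induced : ∀ i (u v : Vertex (Ds i)) →
      Digraph.Arc D (embed i u) (embed i v) ⇔ Digraph.Arc (Ds i) u v
    between : ∀ {i j} → i ≢ j → (u : Vertex (Ds i)) (v : Vertex (Ds j)) →
      ExactlyOne (Digraph.Arc D (embed i u) (embed j v))
                 (Digraph.Arc D (embed j v) (embed i u))

sumOver : ∀ {k} → Subset k → (Fin k → ℕ) → ℕ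
sumOver S n = sum (tabulate λ i → if lookup S i then n i else 0)

_IsMaximumOf_ : ℕ → (ℕ → Set) → Set
m IsMaximumOf P = P m × (∀ x → P x → x ≤ m)

{-# OPTIONS --safe #-}
module Submission where

-- Assertion (iii) always holds.  Two disjoint cycles X and Y, adjacent between
-- each other and joined by arcs in both directions, merge into one cycle, and
-- short cycles of every length up to |Y| + 1 exist: otherwise "x j → y i",
-- viewed as a relation on the torus of index pairs (j , i), is invariant under
-- enough shifts to be constant.  Merging as long as possible turns any family
-- of cycles into a chain R₁ ⇒ ⋯ ⇒ Rₚ, all arcs between two members going
-- forward.  For the whole of D strength forces p = 1, so D is Hamiltonian.  For
-- the cycles other than a fixed M there are arcs x → y with x in M, y in R₁,
-- and z → x′ with z in Rₚ, x′ in M; paths from y to z in the chain have every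
-- order from 2 to the total, so going back through M from x′ to x gives all
-- long cycles, and the short ones come from x′ → y or else from M and R₁, which
-- are then joined in both directions.

open import Defs
open import Data.Fin as Fin using (Fin)
open import Data.Fin.Subset using (∣_∣; ⊤; inside; outside)
open import Data.Fin.Subset.Properties using (∣⊤∣≡n; ∣p∣≡n⇒p≡⊤)
open import Data.Nat using (ℕ; zero; suc; _+_; _*_; _∸_; _≤_; _<_; z≤n; s≤s; _%_; _/_)
open import Data.Product using (_×_; ∃-syntax; _,_; proj₁; proj₂; ∃₂)
open import Data.Sum as Sum using (_⊎_; inj₁; inj₂)
open import Data.Empty using (⊥; ⊥-elim)
open import Data.List using (List; []; _∷_; _++_; _∷ʳ_; length; map; concatMap; tabulate; allFin)
open import Data.List.Membership.Propositional using (_∈_; find)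
open import Data.List.Membership.Propositional.Properties using (∈-++⁻; ∈-++⁺ˡ; ∈-++⁺ʳ; ∈-map⁺; ∈-map⁻; ∈-∃++; ∈-allFin)
open import Data.List.Membership.Propositional.Properties.WithK using (unique∧set⇒bag)
open import Data.List.Properties using (length-++; length-map; length-tabulate; map-tabulate; ++-assoc; ++-identityʳ)
open import Data.List.Relation.Binary.BagAndSetEquality using (∼bag⇒↭)
open import Data.List.Relation.Binary.Permutation.Propositional
  using (_↭_; ↭-refl; ↭-sym; ↭-trans; ↭-reflexive; ↭-prep; ↭-swap; ↭⇒↭ₛ; module PermutationReasoning)
open import Data.List.Relation.Binary.Permutation.Propositional.Properties
  using (↭-length; ∈-resp-↭; ∷↭∷ʳ; shifts)
  renaming (shift to ↭-shift; map⁺ to ↭-map⁺; ++⁺ to ↭-++⁺; ++⁺ˡ to ↭-++⁺ˡ; ++⁺ʳ to ↭-++⁺ʳ; ++-comm to ↭-++-comm; ++-assoc to ↭-++-assoc)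
open import Data.List.Relation.Binary.Permutation.Setoid.Properties using (Unique-resp-↭)
open import Data.List.Relation.Unary.All as All using (All; []; _∷_)
import Data.List.Relation.Unary.All.Properties as All
open import Data.List.Relation.Unary.AllPairs using ([]; _∷_)
open import Data.List.Relation.Unary.Any using (here; there)
open import Data.List.Relation.Unary.Unique.Propositional using (Unique)
import Data.List.Relation.Unary.Unique.Propositional.Properties as Unique
open import Data.List.Relation.Unary.Linked using (Linked; [-]; _∷_)
open import Data.Nat.ListAction using (sum)
open import Data.Nat.ListAction.Properties using (sum-↭)
open import Data.Vec as Vec using (_∷_)
open import Function.Bundles using (Equivalence; Injection; Inverse; mk⇔)
open import Function.Properties.Inverse using (Inverse⇒Injection)
open import Data.Nat.DivMod using (m≡m%n+[m/n]*n; m%n<n)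
open import Data.Nat.Properties
open import Data.Nat.Tactic.RingSolver using (solve-∀)
open import Function using (_∘_; id; flip)
open import Level using (0ℓ)
open import Relation.Binary using (Rel; Decidable)
open import Relation.Binary.PropositionalEquality
open import Relation.Nullary using (¬_; Dec; yes; no; contradiction; ¬?; _×-dec_; decidable-stable)

-- Fragments of duplicate-free lists

infix 4 _≲_

-- Containment of multisets, with the complement as witness. A walk may list its vertices in any
-- order and still inherit distinctness from the duplicate-free list that contains them.
_≲_ : {A : Set} → List A → List A → Set
xs ≲ zs = ∃[ ys ] xs ++ ys ↭ zs

module _ {A : Set} where

  unique-++ˡ : ∀ (xs : List A) {ys} → Unique (xs ++ ys) → Unique xs
  unique-++ˡ []       _        = []
  unique-++ˡ (x ∷ xs) (px ∷ u) = All.++⁻ˡ xs px ∷ unique-++ˡ xs u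

  ≲-unique : ∀ {xs zs : List A} → xs ≲ zs → Unique zs → Unique xs
  ≲-unique {xs} (_ , p) u =
    unique-++ˡ xs (Unique-resp-↭ (setoid A) (↭⇒↭ₛ (↭-sym p)) u)

  ↭⇒≲ : ∀ {xs zs : List A} → xs ↭ zs → xs ≲ zs
  ↭⇒≲ {xs} p = [] , ↭-trans (↭-reflexive (++-identityʳ xs)) p

  ≲-resp-↭ : ∀ {xs ys zs : List A} → xs ≲ ys → ys ↭ zs → xs ≲ zs
  ≲-resp-↭ (rs , p) q = rs , ↭-trans p q

  ↭-resp-≲ : ∀ {xs ys zs : List A} → xs ↭ ys → ys ≲ zs → xs ≲ zs
  ↭-resp-≲ p (rs , q) = rs , ↭-trans (↭-++⁺ʳ rs p) q

  ≲-++⁺ : ∀ {xs ys ws zs : List A} → xs ≲ ws → ys ≲ zs → xs ++ ys ≲ ws ++ zs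
  ≲-++⁺ {xs} {ys} {ws} {zs} (as , p) (bs , q) = as ++ bs , (begin
    (xs ++ ys) ++ as ++ bs   ↭⟨ ↭-++-assoc xs ys (as ++ bs) ⟩
    xs ++ ys ++ as ++ bs     ↭⟨ ↭-++⁺ˡ xs (shifts ys as) ⟩
    xs ++ as ++ ys ++ bs     ↭⟨ ↭-++-assoc xs as (ys ++ bs) ⟨
    (xs ++ as) ++ ys ++ bs   ↭⟨ ↭-++⁺ p q ⟩
    ws ++ zs                 ∎)
    where open PermutationReasoning

  ≲-++ˡ : ∀ {xs zs : List A} ws → xs ≲ zs → xs ≲ ws ++ zs
  ≲-++ˡ ws p = ≲-++⁺ (ws , ↭-refl) p

-- Segments of sequences

seg : {A : Set} → (ℕ → A) → ℕ → ℕ → List A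
seg f i zero    = []
seg f i (suc n) = f i ∷ seg f (suc i) n

module _ {A : Set} where

  length-seg : ∀ (f : ℕ → A) i n → length (seg f i n) ≡ n
  length-seg f i zero    = refl
  length-seg f i (suc n) = cong suc (length-seg f (suc i) n)

  seg-∷ʳ : ∀ (f : ℕ → A) i n → seg f i (suc n) ≡ seg f i n ∷ʳ f (n + i)
  seg-∷ʳ f i zero    = refl
  seg-∷ʳ f i (suc n) = cong (f i ∷_)
    (trans (seg-∷ʳ f (suc i) n) (cong (λ k → seg f (suc i) n ∷ʳ f k) (+-suc n i)))

  seg-++ : ∀ (f : ℕ → A) i m n → seg f i (m + n) ≡ seg f i m ++ seg f (m + i) n
  seg-++ f i zero    n = refl
  seg-++ f i (suc m) n = cong (f i ∷_)
    (trans (seg-++ f (suc i) m n) (cong (λ k → seg f (suc i) m ++ seg f k n) (+-suc m i)))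

  seg-cong : ∀ {f g : ℕ → A} → (∀ i → f i ≡ g i) → ∀ i n → seg f i n ≡ seg g i n
  seg-cong f≗g i zero    = refl
  seg-cong f≗g i (suc n) = cong₂ _∷_ (f≗g i) (seg-cong f≗g (suc i) n)

  seg-suc : ∀ (f : ℕ → A) i n → seg f (suc i) n ≡ seg (f ∘ suc) i n
  seg-suc f i zero    = refl
  seg-suc f i (suc n) = cong (f (suc i) ∷_) (seg-suc f (suc i) n)

  ∈-seg⁻ : ∀ (f : ℕ → A) i n {v} → v ∈ seg f i n → ∃[ j ] v ≡ f j
  ∈-seg⁻ f i (suc n) (here v≡fi) = i , v≡fi
  ∈-seg⁻ f i (suc n) (there v∈)  = ∈-seg⁻ f (suc i) n v∈

-- Walks and rings

-- The list index holds all visited vertices, both ends included. Repetitions are allowed;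
-- distinctness is proved separately.
data Walk {V : Set} (Arc : Rel V 0ℓ) : V → V → List V → Set where
  end : ∀ {v} → Walk Arc v v (v ∷ [])
  _∷_ : ∀ {u w v xs} → Arc u w → Walk Arc w v xs → Walk Arc u v (u ∷ xs)

infixr 5 _++⟨_⟩_

_++⟨_⟩_ : ∀ {V : Set} {Arc : Rel V 0ℓ} {u v w z xs ys} →
  Walk Arc u v xs → Arc v w → Walk Arc w z ys → Walk Arc u z (xs ++ ys)
end     ++⟨ a ⟩ q = a ∷ q
(b ∷ p) ++⟨ a ⟩ q = b ∷ (p ++⟨ a ⟩ q)

map-walk : ∀ {V W : Set} {A : Rel V 0ℓ} {B : Rel W 0ℓ} (f : V → W) →
  (∀ {u v} → A u v → B (f u) (f v)) →
  ∀ {u v xs} → Walk A u v xs → Walk B (f u) (f v) (map f xs)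
map-walk f hom end     = end
map-walk f hom (a ∷ p) = hom a ∷ map-walk f hom p

-- A cycle unrolled to a periodic sequence.
record Ring {V : Set} (Arc : Rel V 0ℓ) : Set where
  field
    pred   : ℕ
    at     : ℕ → V
    step   : ∀ i → Arc (at i) (at (suc i))
    period : ∀ i → at (suc pred + i) ≡ at i
    unique : Unique (seg at 0 (suc pred))

  len : ℕ
  len = suc pred

  verts : List V
  verts = seg at 0 len

  rotate : ∀ i → seg at i len ↭ verts
  rotate zero    = ↭-refl
  rotate (suc i) = begin
    seg at (suc i) len                        ≡⟨ seg-∷ʳ at (suc i) pred ⟩
    seg at (suc i) pred ∷ʳ at (pred + suc i)  ≡⟨ cong (λ v → seg at (suc i) pred ∷ʳ v)
                                                   (trans (cong at (+-suc pred i)) (period i)) ⟩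
    seg at (suc i) pred ∷ʳ at i               ↭⟨ ∷↭∷ʳ (at i) (seg at (suc i) pred) ⟨
    seg at i len                              ↭⟨ rotate i ⟩
    verts                                     ∎
    where open PermutationReasoning

  at∈ : ∀ i → at i ∈ verts
  at∈ i = ∈-resp-↭ (rotate i) (here refl)

  index : ∀ {v} → v ∈ verts → ∃[ i ] v ≡ at i
  index = ∈-seg⁻ at 0 len

  seg-≲ : ∀ i {n} → n ≤ len → seg at i n ≲ verts
  seg-≲ i {n} n≤len with m≤n⇒∃[o]m+o≡n n≤len
  ... | r , n+r≡len = seg at (n + i) r , (begin
    seg at i n ++ seg at (n + i) r  ≡⟨ seg-++ at i n r ⟨
    seg at i (n + r)                ≡⟨ cong (seg at i) n+r≡len ⟩
    seg at i len                    ↭⟨ rotate i ⟩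
    verts                           ∎)
    where open PermutationReasoning

  periods : ∀ k i → at (k * len + i) ≡ at i
  periods zero    i = refl
  periods (suc k) i = trans (cong at (+-assoc len (k * len) i)) (trans (period (k * len + i)) (periods k i))

  seg-walk : ∀ i n → Walk Arc (at i) (at (n + i)) (seg at i (suc n))
  seg-walk i zero    = end
  seg-walk i (suc n) = step i ∷ subst (λ k → Walk Arc (at (suc i)) (at k) (seg at (suc i) (suc n)))
    (+-suc n i) (seg-walk (suc i) n)

  round : ∀ i → Walk Arc (at (suc i)) (at i) (seg at (suc i) len)
  round i = subst (λ v → Walk Arc (at (suc i)) v (seg at (suc i) len))
    (trans (cong at (+-suc pred i)) (period i)) (seg-walk (suc i) pred)

  reach : ∀ i j → ∃[ h ] h < len × at (h + i) ≡ at j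
  reach i j = m % len , m%n<n m len , (begin
    at (m % len + i)                    ≡⟨ periods (m / len) (m % len + i) ⟨
    at (m / len * len + (m % len + i))  ≡⟨ cong at (arith₁ (m / len * len) (m % len) i) ⟩
    at (m % len + m / len * len + i)    ≡⟨ cong (λ k → at (k + i)) (m≡m%n+[m/n]*n m len) ⟨
    at (m + i)                          ≡⟨ cong at (arith₂ i j pred) ⟩
    at (i * len + j)                    ≡⟨ periods i j ⟩
    at j                                ∎)
    where
    open ≡-Reasoning
    -- This is `j - i` modulo `len`, as `pred` is congruent to `-1`; truncated subtraction is
    -- avoided.
    m = j + i * pred
    arith₁ : ∀ a b c → a + (b + c) ≡ b + a + c
    arith₁ = solve-∀
    arith₂ : ∀ i j p → (j + i * p) + i ≡ i * suc p + j
    arith₂ = solve-∀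

  -- By periodicity only the indices below `len` need testing. The offset `d` allows `Q` to compare
  -- two positions at a fixed distance.
  anyIndex? : ∀ d {Q : V → V → Set} → Decidable Q → Dec (∃[ i ] Q (at i) (at (d + i)))
  anyIndex? d {Q} Q? with anyUpTo? (λ i → Q? (at i) (at (d + i))) len
  ... | yes (i , _ , q) = yes (i , q)
  ... | no  ¬q          = no λ (i , q) → ¬q (i % len , m%n<n i len , subst₂ Q (reduce₀ i) (reduce i) q)
    where
    reduce : ∀ i → at (d + i) ≡ at (d + i % len)
    reduce i = trans (cong at (trans (cong (d +_) (m≡m%n+[m/n]*n i len)) (lemma d (i % len) (i / len * len))))
                     (periods (i / len) (d + i % len))
      where
      lemma : ∀ a b c → a + (b + c) ≡ c + (a + b)
      lemma = solve-∀
    reduce₀ : ∀ i → at i ≡ at (i % len)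
    reduce₀ i = trans (cong at (trans (m≡m%n+[m/n]*n i len) (+-comm (i % len) _)))
                      (periods (i / len) (i % len))

open Ring using (len; verts)

-- Closing a walk into a ring

module _ {V : Set} {Arc : Rel V 0ℓ} {u v xs} (p : Walk Arc u v xs) (closing : Arc v u) where

  private
    -- A state is the part of the closed walk still to be traversed. `next` drops its first vertex
    -- and restarts after the last one, so iterating it unrolls the cycle.
    State : Set
    State = ∃₂ λ x ys → Walk Arc x v ys

    start : State
    start = u , xs , p

    next : State → State
    next (_ , _ , end)   = start
    next (_ , _ , _ ∷ q) = _ , _ , q

    orbit : ℕ → State → State
    orbit zero    s = s
    orbit (suc i) s = next (orbit i s)

    orbit-+ : ∀ i m s → orbit (i + m) s ≡ orbit i (orbit m s)
    orbit-+ zero    m s = refl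
    orbit-+ (suc i) m s = cong next (orbit-+ i m s)

    orbit-next : ∀ i s → orbit (suc i) s ≡ orbit i (next s)
    orbit-next i s = trans (cong (λ k → orbit k s) (+-comm 1 i)) (orbit-+ i 1 s)

    next-arc : ∀ s → Arc (proj₁ s) (proj₁ (next s))
    next-arc (_ , _ , end)   = closing
    next-arc (_ , _ , a ∷ q) = a

    orbit-length : ∀ {x ys} (q : Walk Arc x v ys) → orbit (length ys) (x , ys , q) ≡ start
    orbit-length end             = refl
    orbit-length (_∷_ {xs = ys} a q) = trans (orbit-next (length ys) _) (orbit-length q)

    orbit-seg : ∀ {x ys} (q : Walk Arc x v ys) →
      seg (λ i → proj₁ (orbit i (x , ys , q))) 0 (length ys) ≡ ys
    orbit-seg end             = refl
    orbit-seg {x} (_∷_ {xs = ys} a q) = cong (x ∷_)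
      (trans (seg-suc (λ i → proj₁ (orbit i (x , x ∷ ys , a ∷ q))) 0 (length ys))
      (trans (seg-cong (λ i → cong proj₁ (orbit-next i (x , x ∷ ys , a ∷ q))) 0 (length ys)) (orbit-seg q)))

    walk-length : ∀ {x y ys} → Walk Arc x y ys → ∃[ n ] length ys ≡ suc n
    walk-length end     = _ , refl
    walk-length (_ ∷ _) = _ , refl

  closeRing : Unique xs → ∃[ X ] verts {Arc = Arc} X ≡ xs
  closeRing uniq with walk-length p
  ... | n , eq = record
    { pred   = n
    ; at     = λ i → proj₁ (orbit i start)
    ; step   = λ i → next-arc (orbit i start)
    ; period = λ i → cong proj₁ (trans (cong (λ k → orbit k start) (+-comm (suc n) i))
                 (trans (orbit-+ i (suc n) start) (cong (orbit i) (subst (λ k → orbit k start ≡ start) eq (orbit-length p)))))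
    ; unique = subst Unique (sym seg≡) uniq
    } , seg≡
    where
    seg≡ : seg (λ i → proj₁ (orbit i start)) 0 (suc n) ≡ xs
    seg≡ = subst (λ k → seg (λ i → proj₁ (orbit i start)) 0 k ≡ xs) eq (orbit-seg p)

-- Doubly periodic relations

module _ {T : ℕ → Set} {p} (per : ∀ k i → T (k * suc p + i) ≡ T i) where

  -- Climbing `i′ + i * p` steps from `i` ends at `i′` plus a multiple of the period.
  up-closed⇒constant : (∀ i → T i → T (suc i)) → ∀ i i′ → T i → T i′
  up-closed⇒constant up i i′ t = subst id
    (trans (cong T (arith i i′ p)) (per i i′)) (climb (i′ + i * p) t)
    where
    climb : ∀ k → T i → T (k + i)
    climb zero    t = t
    climb (suc k) t = up _ (climb k t)
    arith : ∀ i i′ p → (i′ + i * p) + i ≡ i * suc p + i′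
    arith = solve-∀

module _ {S : ℕ → ℕ → Set} where

  iterate : ∀ {e} → (∀ j i → S (suc j) i → S j (e + i)) → ∀ k j i → S (k + j) i → S j (k * e + i)
  iterate         f zero    j i s = s
  iterate {e = e} f (suc k) j i s = subst (S j) (arith k e i) (iterate f k j (e + i) (f (k + j) i s))
    where
    arith : ∀ k e i → k * e + (e + i) ≡ suc k * e + i
    arith = solve-∀

  -- A shift has finite order on the torus, so closure under it is invariance.
  reverse : ∀ {p q} → (∀ k j i → S (k * suc p + j) i ≡ S j i) → (∀ k j i → S j (k * suc q + i) ≡ S j i) →
    ∀ {e} → (∀ j i → S (suc j) i → S j (e + i)) → ∀ j i → S j (e + i) → S (suc j) i
  reverse {p} {q} per₁ per₂ {e} f j i s = subst id (trans (cong (S (suc j)) (arith₂ p q e i)) (per₂ (e * suc p) (suc j) i))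
    -- The count is one less than the product of the periods `suc p` and `suc q`; applying the shift
    -- that many times inverts it.
    (iterate f (q + p * suc q) (suc j) (e + i)
      (subst id (sym (trans (cong (λ k → S k (e + i)) (arith₁ p q j)) (per₁ (suc q) j (e + i)))) s))
    where
    arith₁ : ∀ p q j → (q + p * suc q) + suc j ≡ suc q * suc p + j
    arith₁ = solve-∀
    arith₂ : ∀ p q e i → (q + p * suc q) * e + (e + i) ≡ (e * suc p) * suc q + i
    arith₂ = solve-∀

-- Adjacency, domination and closed walks in a digraph

Between : {V : Set} → Rel V 0ℓ → List V → List V → Set
Between R xs ys = ∀ {u v} → u ∈ xs → v ∈ ys → R u v

module _ (D : Digraph) where
  open Digraph D using (Arc; arc?; loopless)
  open Ring using (pred; at; at∈; index; period; periods; seg-≲; seg-walk; round; anyIndex?; rotate)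

  Adjacent : Rel (Vertex D) 0ℓ
  Adjacent u v = ExactlyOne (Arc u v) (Arc v u)

  Dominates : Rel (Vertex D) 0ℓ
  Dominates u v = Arc u v × ¬ Arc v u

  adjacent-sym : ∀ {u v} → Adjacent u v → Adjacent v u
  adjacent-sym (inj₁ (a , ¬b)) = inj₂ (¬b , a)
  adjacent-sym (inj₂ (¬a , b)) = inj₁ (b , ¬a)

  adjacent-irrefl : ∀ {u} → ¬ Adjacent u u
  adjacent-irrefl (inj₁ (a , ¬a)) = ¬a a
  adjacent-irrefl (inj₂ (¬a , a)) = ¬a a

  backward : ∀ {u v} → Adjacent u v → ¬ Arc u v → Arc v u
  backward (inj₁ (a , _)) ¬a = contradiction a ¬a
  backward (inj₂ (_ , b)) _  = b

  not-both : ∀ {u v} → Adjacent u v → Arc u v → ¬ Arc v u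
  not-both (inj₁ (_ , ¬b)) _ = ¬b
  not-both (inj₂ (¬a , _)) a = contradiction a ¬a

  unique-++ : ∀ {xs ys} → Between Adjacent xs ys → Unique xs → Unique ys → Unique (xs ++ ys)
  unique-++ xs∼ys uxs uys = Unique.++⁺ uxs uys λ (v∈xs , v∈ys) → adjacent-irrefl (xs∼ys v∈xs v∈ys)

  walk⇒linked : ∀ {u v w xs} → Walk Arc u v xs → Arc v w → Linked Arc (xs ∷ʳ w)
  walk⇒linked end             a = a ∷ [-]
  walk⇒linked (b ∷ end)       a = b ∷ walk⇒linked end a
  walk⇒linked (b ∷ p@(_ ∷ _)) a = b ∷ walk⇒linked p a

  closeCycle : ∀ {u v xs} → Walk Arc u v xs → Arc v u → Unique xs → ∃[ c ] Cycle.vertices {D} c ≡ xs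
  closeCycle end       a uniq = contradiction a (loopless refl)
  closeCycle p@(_ ∷ _) a uniq =
    record { start = _ ; rest = _ ; distinct = uniq ; arcs = walk⇒linked p a } , refl

  -- All cycles of prescribed length are obtained here: the walk is distinct because it fits into a
  -- duplicate-free list.
  close : ∀ {u v xs zs n} → Walk Arc u v xs → Arc v u → xs ≲ zs → Unique zs → length xs ≡ n →
    HasCycleOfLength D n
  close p a xs≲zs uniq refl with closeCycle p a (≲-unique xs≲zs uniq)
  ... | c , refl = c , refl

  -- With period one the first step would be a loop.
  len>1 : ∀ (X : Ring Arc) → 2 ≤ len X
  len>1 X = go (pred X) (period X 0)
    where
    go : ∀ p → at X (suc p + 0) ≡ at X 0 → 2 ≤ suc p
    go zero    eq = contradiction (Ring.step X 0) (loopless (sym eq))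
    go (suc _) eq = s≤s (s≤s z≤n)

  -- Two rings with arcs in both directions

  record Mixed (X Y : Ring Arc) : Set where
    field
      adjacent : Between Adjacent (verts X) (verts Y)
      forth    : ∃₂ λ j i → Arc (at X j) (at Y i)
      back     : ∃₂ λ j i → Arc (at Y i) (at X j)

    vertices-unique : Unique (verts X ++ verts Y)
    vertices-unique = unique-++ adjacent (Ring.unique X) (Ring.unique Y)

    arc-back : ∀ {j i} → ¬ Arc (at X j) (at Y i) → Arc (at Y i) (at X j)
    arc-back = backward (adjacent (at∈ X _) (at∈ Y _))

    private
      S : ℕ → ℕ → Set
      S j i = Arc (at X j) (at Y i)

    per₁ : ∀ k j i → S (k * len X + j) i ≡ S j i
    per₁ k j i = cong (λ u → Arc u (at Y i)) (periods X k j)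

    per₂ : ∀ k j i → S j (k * len Y + i) ≡ S j i
    per₂ k j i = cong (Arc (at X j)) (periods Y k i)

    -- Closure under both unit shifts spreads the arc of `forth` to every pair of indices, including
    -- the pair of `back`.
    not-constant : (∀ j i → S j i → S j (suc i)) → (∀ j i → S j i → S (suc j) i) → ⊥
    not-constant right down with forth | back
    ... | j , i , a | j′ , i′ , b = not-both (adjacent (at∈ X j′) (at∈ Y i′))
      (up-closed⇒constant {λ k → S k i′} {pred X} (λ k j → per₁ k j i′) (λ k → down k i′) j j′
        (up-closed⇒constant {S j} {pred Y} (λ k i → per₂ k j i) (right j) i i′ a)) b

  mixed-sym : ∀ {X Y} → Mixed X Y → Mixed Y X
  mixed-sym mixed = record
    { adjacent = λ u∈ v∈ → adjacent-sym (adjacent v∈ u∈)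
    ; forth    = let j , i , a = back in i , j , a
    ; back     = let j , i , a = forth in i , j , a
    }
    where open Mixed mixed

  ringOn : ∀ {u v xs zs} → Walk Arc u v xs → Arc v u → xs ↭ zs → Unique zs →
    ∃[ Z ] verts {Arc = Arc} Z ↭ zs
  ringOn p a xs↭zs uniq =
    let Z , Z≡ = closeRing p a (≲-unique (↭⇒≲ xs↭zs) uniq)
    in Z , ↭-trans (↭-reflexive Z≡) xs↭zs

  Merge : Ring Arc → Ring Arc → Set
  Merge X Y = ∃[ Z ] verts {Arc = Arc} Z ↭ verts X ++ verts Y

  module _ {X Y : Ring Arc} (mixed : Mixed X Y) where
    open Mixed mixed

    private
      x = at X
      y = at Y

    -- The arcs `x j → x (suc j)` and `y i → y (suc i)` are removed and the two remaining paths
    -- joined crosswise; the absent arc supplies the return from `y i` to `x (suc j)`.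
    exchange : ∀ {j i} → Arc (x j) (y (suc i)) → ¬ Arc (x (suc j)) (y i) → Merge X Y
    exchange {j} {i} a ¬b = ringOn (round X j ++⟨ a ⟩ round Y i) (arc-back ¬b)
      (↭-++⁺ (rotate X (suc j)) (rotate Y (suc i))) vertices-unique

    module Zigzag (c q : ℕ) where

      -- X is visited upwards and Y downwards in alternation, which keeps the index sums of the
      -- crossing arcs at two consecutive values. After `r` vertices of Y, the `suc q` others follow
      -- along Y itself.
      zigzag : ℕ → ℕ → List (Vertex D)
      zigzag zero    j = x j ∷ seg y c (suc q)
      zigzag (suc r) j = x j ∷ y (suc r + (q + c)) ∷ zigzag r (suc j)

      zigzag-↭ : ∀ r j → zigzag r j ↭ seg x j (suc r) ++ seg y c (suc r + q)
      zigzag-↭ zero    j = ↭-refl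
      zigzag-↭ (suc r) j = ↭-prep (x j) (begin
        v ∷ zigzag r (suc j)  ↭⟨ ↭-prep v (zigzag-↭ r (suc j)) ⟩
        v ∷ xs ++ ys          ↭⟨ ∷↭∷ʳ v (xs ++ ys) ⟩
        (xs ++ ys) ∷ʳ v       ≡⟨ ++-assoc xs ys _ ⟩
        xs ++ ys ∷ʳ v         ≡⟨ cong (λ k → xs ++ ys ∷ʳ y k) (+-assoc (suc r) q c) ⟨
        xs ++ ys ∷ʳ y (suc r + q + c)  ≡⟨ cong (xs ++_) (seg-∷ʳ y c (suc r + q)) ⟨
        xs ++ seg y c (suc (suc r) + q) ∎)
        where
        open PermutationReasoning
        v  = y (suc r + (q + c))
        xs = seg x (suc j) (suc r)
        ys = seg y c (suc r + q)

      zigzag-walk : ∀ {m} → Arc (x m) (y c) →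
        (∀ r j → r + j ≡ m → Arc (x j) (y (r + (q + c)))) →
        (∀ r j → r + j ≡ m → ¬ Arc (x (suc j)) (y (r + (q + c)))) →
        ∀ r j → r + j ≡ m → Walk Arc (x j) (y (q + c)) (zigzag r j)
      zigzag-walk last forth back zero    j refl = last ∷ seg-walk Y c q
      zigzag-walk last forth back (suc r) j eq   =
        forth (suc r) j eq ∷ arc-back (back (suc r) j eq) ∷
        zigzag-walk last forth back r (suc j) (trans (+-suc r j) eq)

    -- Without an exchange the arcs from X to Y depend only on the sum of the
    -- indices, and a zigzag starting where this dependence changes closes up.
    merge-≤ : pred X ≤ pred Y → Merge X Y
    merge-≤ X≤Y with anyIndex? X 1 (λ u u′ → anyIndex? Y 1 (λ v v′ → arc? u v′ ×-dec ¬? (arc? u′ v)))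
    ... | yes (j , i , a , ¬b) = exchange a ¬b
    ... | no ¬exchange = by-zigzag (m≤n⇒∃[o]m+o≡n X≤Y)
      where
      anti : ∀ j i → Arc (x j) (y (suc i)) → Arc (x (suc j)) (y i)
      anti j i a = decidable-stable (arc? _ _) λ ¬b → ¬exchange (j , i , a , ¬b)

      anti⁻¹ : ∀ j i → Arc (x (suc j)) (y i) → Arc (x j) (y (suc i))
      anti⁻¹ j i = reverse {λ i j → Arc (x j) (y i)} {pred Y} {pred X}
        (λ k i j → per₂ k j i) (λ k i j → per₁ k j i) {1} (λ i j → anti j i) i j

      F : ℕ → Set
      F t = Arc (x 0) (y t)

      toF : ∀ j i {t} → j + i ≡ t → Arc (x j) (y i) → F t
      toF zero    i refl a = a
      toF (suc j) i eq   a = toF j (suc i) (trans (+-suc j i) eq) (anti⁻¹ j i a)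

      fromF : ∀ j i {t} → j + i ≡ t → F t → Arc (x j) (y i)
      fromF zero    i refl a = a
      fromF (suc j) i eq   a = anti j i (fromF j (suc i) (trans (+-suc j i) eq) a)

      by-zigzag : (∃[ q ] pred X + q ≡ pred Y) → Merge X Y
      by-zigzag (q , p+q≡) with anyIndex? X 0 (λ u _ → anyIndex? Y 1 (λ v v′ → arc? u v ×-dec ¬? (arc? u v′)))
      ... | no ¬change = ⊥-elim (not-constant right λ j i a → anti j i (right j i a))
        where
        right : ∀ j i → Arc (x j) (y i) → Arc (x j) (y (suc i))
        right j i a = decidable-stable (arc? _ _) λ ¬b → ¬change (j , i , a , ¬b)
      ... | yes (j₀ , i₀ , a , ¬b) =
        ringOn (zigzag-walk last forth′ back′ (pred X) 0 (+-identityʳ _))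
          -- The closing arc runs from `y (q + c)` to `x (len X)`, which is `x 0`.
          (subst (Arc _) (trans (cong x (sym (+-identityʳ (len X)))) (period X 0))
            (arc-back (back′ 0 (pred X) refl)))
          perm vertices-unique
        where
        t c : ℕ
        t = j₀ + i₀
        c = suc t
        open Zigzag c q

        Ft : F t
        Ft = toF j₀ i₀ refl a

        ¬Fc : ¬ F c
        ¬Fc f = ¬b (fromF j₀ (suc i₀) (+-suc j₀ i₀) f)

        -- The index sum is `len X + t`, and `F` inherits the period `len X` because `x (len X)` is
        -- `x 0`.
        last : Arc (x (pred X)) (y c)
        last = fromF (pred X) c refl (subst F (sym (+-suc (pred X) t))
          (toF (len X) t refl (subst (λ u → Arc u (y t))
            (sym (trans (cong x (sym (+-identityʳ (len X)))) (period X 0))) Ft)))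

        total : ∀ r j → r + j ≡ pred X → j + (r + (q + c)) ≡ pred Y + c
        total r j eq = trans (arith r j q c) (cong (_+ c) (trans (cong (_+ q) eq) p+q≡))
          where
          arith : ∀ r j q c → j + (r + (q + c)) ≡ ((r + j) + q) + c
          arith = solve-∀

        -- In the alternating part, arcs leaving X have index sum `pred Y + c`, which is `t` up to
        -- the period of Y. For the returning arcs the sum is one larger, hence `c` up to that
        -- period, where `F` fails.
        forth′ : ∀ r j → r + j ≡ pred X → Arc (x j) (y (r + (q + c)))
        forth′ r j eq = fromF j _ (total r j eq)
          (subst (Arc (x 0)) (sym (trans (cong y (+-suc (pred Y) t)) (period Y t))) Ft)

        back′ : ∀ r j → r + j ≡ pred X → ¬ Arc (x (suc j)) (y (r + (q + c)))
        back′ r j eq b = ¬Fc (subst (Arc (x 0)) (period Y c) (toF (suc j) _ (cong suc (total r j eq)) b))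

        perm : zigzag (pred X) 0 ↭ verts X ++ verts Y
        perm = ↭-trans (zigzag-↭ (pred X) 0) (↭-++⁺ˡ (verts X)
          (↭-trans (↭-reflexive (cong (λ k → seg y c (suc k)) p+q≡)) (rotate Y c)))

    -- A cycle uses one vertex of X, two consecutive ones, or two vertices of X
    -- separated by one of Y; if none of these closes, all arcs agree.
    short-cycles : ∀ l → 3 ≤ l → l ≤ suc (len Y) → HasCycleOfLength D l
    short-cycles _ (s≤s (s≤s (s≤s {n = e} z≤n))) (s≤s d<len)
      -- Here `l` is `3 + e`. The first search yields a cycle with `e + 2` vertices of Y, the second
      -- one with `e + 1`; the third looks for `x j → y i → x (suc j)`.
      with anyIndex? X 0 (λ u _ → anyIndex? Y (suc e) (λ v v′ → arc? u v ×-dec ¬? (arc? u v′)))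
         | anyIndex? X 1 (λ u u′ → anyIndex? Y e (λ v v′ → arc? u′ v ×-dec ¬? (arc? u v′)))
         | anyIndex? X 1 (λ u u′ → anyIndex? Y 0 (λ v _ → arc? u v ×-dec ¬? (arc? u′ v)))
    ... | yes (j , i , a , ¬b) | _ | _ =
      close (a ∷ seg-walk Y i (suc e)) (arc-back ¬b)
        (≲-++⁺ (seg-≲ X j {1} (s≤s z≤n)) (seg-≲ Y i d<len)) vertices-unique
        (cong suc (length-seg y i (suc (suc e))))
    ... | no _ | yes (j , i , a , ¬b) | _ =
      close (Ring.step X j ∷ a ∷ seg-walk Y i e) (arc-back ¬b)
        (≲-++⁺ (seg-≲ X j {2} (len>1 X)) (seg-≲ Y i (≤-trans (n≤1+n _) d<len))) vertices-unique
        (cong (2 +_) (length-seg y i (suc e)))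
    ... | no ¬shift | no ¬skew | change = remaining change
      where
      shift : ∀ j i → Arc (x j) (y i) → Arc (x j) (y (suc e + i))
      shift j i a = decidable-stable (arc? _ _) λ ¬b → ¬shift (j , i , a , ¬b)

      skew : ∀ j i → Arc (x (suc j)) (y i) → Arc (x j) (y (e + i))
      skew j i a = decidable-stable (arc? _ _) λ ¬b → ¬skew (j , i , a , ¬b)

      skew⁻¹ : ∀ j i → Arc (x j) (y (e + i)) → Arc (x (suc j)) (y i)
      skew⁻¹ = reverse {λ j i → Arc (x j) (y i)} {pred X} {pred Y} per₁ per₂ skew

      -- The shift by `suc e` along Y followed by the inverse skew, whose offset is `e`, leaves one
      -- step in each direction.
      diagonal : ∀ j i → Arc (x j) (y i) → Arc (x (suc j)) (y (suc i))
      diagonal j i a = skew⁻¹ j (suc i) (subst (λ k → Arc (x j) (y k)) (sym (+-suc e i)) (shift j i a))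

      remaining : Dec _ → _
      remaining (yes (j , i , a , ¬b)) = three-crossings e refl
        where
        three-crossings : ∀ e′ → e ≡ e′ → HasCycleOfLength D (3 + e)
        -- For `e = 0` the skew is the unit shift along X alone, which admits no change.
        three-crossings zero     refl = contradiction (skew⁻¹ j i a) ¬b
        three-crossings (suc e″) refl =
          close (a ∷ arc-back ¬b ∷ diagonal j i a ∷ seg-walk Y (suc i) e″)
            (arc-back λ a′ → ¬b (skew⁻¹ j i (subst (λ k → Arc (x j) (y k)) (+-suc e″ i) a′)))
            (↭-resp-≲ (↭-prep (x j) (↭-swap (y i) (x (suc j)) ↭-refl))
              (≲-++⁺ (seg-≲ X j {2} (len>1 X)) (seg-≲ Y i (≤-trans (n≤1+n _) d<len))))
            vertices-unique (cong (3 +_) (length-seg y (suc i) (suc e″)))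
      -- Closure under the shift along X makes the relation independent of `j`; undoing the X part
      -- of the diagonal gives the unit shift along Y.
      remaining (no ¬change) = ⊥-elim (not-constant
        (λ j i a → column j (suc i) (diagonal j i a)) down)
        where
        down : ∀ j i → Arc (x j) (y i) → Arc (x (suc j)) (y i)
        down j i a = decidable-stable (arc? _ _) λ ¬b → ¬change (j , i , a , ¬b)
        column : ∀ j i → Arc (x (suc j)) (y i) → Arc (x j) (y i)
        column j i = up-closed⇒constant {λ k → Arc (x k) (y i)} {pred X} (λ k j → per₁ k j i)
          (λ k → down k i) (suc j) j

  merge : ∀ {X Y} → Mixed X Y → Merge X Y
  merge {X} {Y} mixed with ≤-total (pred X) (pred Y)
  ... | inj₁ X≤Y = merge-≤ mixed X≤Y
  ... | inj₂ Y≤X with merge-≤ (mixed-sym mixed) Y≤X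
  ...   | Z , p = Z , ↭-trans p (↭-++-comm (verts Y) (verts X))

  -- Chains of rings

  all : List (Ring Arc) → List (Vertex D)
  all = concatMap verts

  data Ordered (R : Rel (Vertex D) 0ℓ) : List (Ring Arc) → Set where
    []  : Ordered R []
    _∷_ : ∀ {X Xs} → Between R (verts X) (all Xs) → Ordered R Xs → Ordered R (X ∷ Xs)

  Chain : List (Ring Arc) → Set
  Chain = Ordered Dominates

  ordered-head : ∀ {R X Xs} → Ordered R (X ∷ Xs) → Between R (verts X) (all Xs)
  ordered-head (p ∷ _) = p

  lastRing : Ring Arc → List (Ring Arc) → Ring Arc
  lastRing X []       = X
  lastRing X (Y ∷ Ys) = lastRing Y Ys

  between-++ˡ : ∀ {R : Rel (Vertex D) 0ℓ} {xs ys zs} →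
    Between R xs zs → Between R ys zs → Between R (xs ++ ys) zs
  between-++ˡ {xs = xs} p q u∈ v∈ with ∈-++⁻ xs u∈
  ... | inj₁ u∈xs = p u∈xs v∈
  ... | inj₂ u∈ys = q u∈ys v∈

  between-++ʳ : ∀ {R : Rel (Vertex D) 0ℓ} {xs ys zs} →
    Between R xs ys → Between R xs zs → Between R xs (ys ++ zs)
  between-++ʳ {ys = ys} p q u∈ v∈ with ∈-++⁻ ys v∈
  ... | inj₁ v∈ys = p u∈ v∈ys
  ... | inj₂ v∈zs = q u∈ v∈zs

  all-∷ʳ : ∀ Xs Y → all (Xs ∷ʳ Y) ≡ all Xs ++ verts Y
  all-∷ʳ []       Y = ++-identityʳ (verts Y)
  all-∷ʳ (X ∷ Xs) Y = trans (cong (verts X ++_) (all-∷ʳ Xs Y)) (sym (++-assoc (verts X) (all Xs) (verts Y)))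

  chain-∷ʳ : ∀ {Xs Y} → Chain Xs → Between Dominates (all Xs) (verts Y) → Chain (Xs ∷ʳ Y)
  chain-∷ʳ []                     _   = (λ _ ()) ∷ []
  chain-∷ʳ {X ∷ Xs} {Y} (p ∷ chain) dom =
    (λ u∈ v∈ → between-++ʳ p (dom ∘ ∈-++⁺ˡ) u∈ (subst (_ ∈_) (all-∷ʳ Xs Y) v∈)) ∷
    chain-∷ʳ chain (dom ∘ ∈-++⁺ʳ (verts X))

  lastRing-∷ʳ : ∀ X Ys Z → lastRing X (Ys ∷ʳ Z) ≡ Z
  lastRing-∷ʳ X []       Z = refl
  lastRing-∷ʳ X (Y ∷ Ys) Z = lastRing-∷ʳ Y Ys Z

  ordered-unique : ∀ {Xs} → Ordered Adjacent Xs → Unique (all Xs)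
  ordered-unique []                = []
  ordered-unique (_∷_ {X} p ordered) = unique-++ p (Ring.unique X) (ordered-unique ordered)

  chain⇒ordered : ∀ {Xs} → Chain Xs → Ordered Adjacent Xs
  chain⇒ordered []          = []
  chain⇒ordered (p ∷ chain) = (λ u∈ v∈ → inj₁ (p u∈ v∈)) ∷ chain⇒ordered chain

  all-[-] : ∀ X → all (X ∷ []) ↭ verts X
  all-[-] X = ↭-reflexive (++-identityʳ (verts X))

  length-verts : ∀ (X : Ring Arc) → length (verts X) ≡ len X
  length-verts X = length-seg (at X) 0 (len X)

  -- Both parts are nonempty; the first is a single vertex unless the second is already full.
  split-length : ∀ {L T} n → 2 ≤ n → n ≤ suc L + suc T →
    ∃₂ λ a b → suc a + suc b ≡ n × suc a ≤ suc L × suc b ≤ suc T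
  split-length {L} {T} (suc (suc m)) (s≤s (s≤s z≤n)) n≤ with m ≤? T
  ... | yes m≤T = 0 , m , refl , s≤s z≤n , s≤s m≤T
  ... | no  m≰T = suc (m ∸ suc T) , T , eq ,
    +-cancelʳ-≤ (suc T) _ (suc L) (≤-trans (≤-reflexive eq) n≤) , ≤-refl
    where
    eq : suc (suc (m ∸ suc T)) + suc T ≡ suc (suc m)
    eq = cong (2 +_) (m∸n+n≡m (≰⇒> m≰T))

  -- Walks of prescribed order along a chain

  mutual
    -- After a stretch of X starting at `u`, the walk can jump to the first vertex of any tail walk,
    -- since X dominates all later rings. This is why `tail-walk` may leave its starting vertex
    -- open.
    chain-walk : ∀ X Y Ys → Chain (X ∷ Y ∷ Ys) → ∀ {u v} → u ∈ verts X → v ∈ verts (lastRing Y Ys) →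
      ∀ n → 2 ≤ n → n ≤ length (all (X ∷ Y ∷ Ys)) →
      ∃[ xs ] Walk Arc u v xs × xs ≲ all (X ∷ Y ∷ Ys) × length xs ≡ n
    chain-walk X Y Ys (p ∷ chain) u∈ v∈ n 2≤n n≤
      with index X u∈
         | split-length {pred X} n 2≤n (≤-trans n≤ (≤-reflexive
             (trans (length-++ (verts X)) (cong (_+ length (all (Y ∷ Ys))) (length-verts X)))))
    ... | i , refl | a , b , eq , a≤ , b≤ with tail-walk Y Ys chain v∈ b b≤
    ...   | w , xs , walk , w∈ , xs≲ , len≡ =
      seg (at X) i (suc a) ++ xs ,
      (seg-walk X i a ++⟨ proj₁ (p (at∈ X (a + i)) w∈) ⟩ walk) ,
      ≲-++⁺ (seg-≲ X i a≤) xs≲ ,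
      trans (length-++ (seg (at X) i (suc a))) (trans (cong₂ _+_ (length-seg (at X) i (suc a)) len≡) eq)

    tail-walk : ∀ X Ys → Chain (X ∷ Ys) → ∀ {v} → v ∈ verts (lastRing X Ys) →
      ∀ n → suc n ≤ length (all (X ∷ Ys)) →
      ∃₂ λ u xs → Walk Arc u v xs × u ∈ all (X ∷ Ys) × xs ≲ all (X ∷ Ys) × length xs ≡ suc n
    tail-walk X [] _ v∈ n n< with index X v∈
    -- The start is `i - n` modulo `len X`, so that `n` steps lead to `v`.
    ... | i , refl = at X (i + n * pred X) , seg (at X) (i + n * pred X) (suc n) ,
      subst (λ v → Walk Arc (at X (i + n * pred X)) v (seg (at X) (i + n * pred X) (suc n))) (trans (cong (at X) (arith n i (pred X))) (periods X n i))
        (seg-walk X (i + n * pred X) n) ,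
      ∈-resp-↭ (↭-sym (all-[-] X)) (at∈ X _) ,
      ≲-resp-↭ (seg-≲ X _ (≤-trans n< (≤-reflexive (trans (↭-length (all-[-] X)) (length-verts X)))))
        (↭-sym (all-[-] X)) ,
      length-seg (at X) (i + n * pred X) (suc n)
      where
      arith : ∀ n i p → n + (i + n * p) ≡ n * suc p + i
      arith = solve-∀
    tail-walk X (Y ∷ Ys) (_ ∷ chain) v∈ zero _ with tail-walk Y Ys chain v∈ zero (s≤s z≤n)
    ... | u , xs , walk , u∈ , xs≲ , len≡ = u , xs , walk , ∈-++⁺ʳ (verts X) u∈ , ≲-++ˡ (verts X) xs≲ , len≡
    tail-walk X (Y ∷ Ys) chain v∈ (suc n) n< with chain-walk X Y Ys chain (at∈ X 0) v∈ (2 + n) (s≤s (s≤s z≤n)) n<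
    ... | xs , walk , xs≲ , len≡ = at X 0 , xs , walk , ∈-++⁺ˡ (at∈ X 0) , xs≲ , len≡

  ≲-full : ∀ {xs zs : List (Vertex D)} → xs ≲ zs → length xs ≡ length zs → xs ↭ zs
  ≲-full {xs} {zs} ([] , p) _ = ↭-trans (↭-reflexive (sym (++-identityʳ xs))) p
  ≲-full {xs} {zs} (y ∷ ys , p) eq = contradiction
    (trans (sym (↭-length p)) (trans (length-++ xs) (cong (_+ _) eq))) (m≢1+m+n _ ∘ flip trans (+-suc _ _))

  -- At maximal order a chain walk exhausts the chain. `insert` uses this to absorb several rings
  -- into one.
  full-walk : ∀ P Ps R → Chain (P ∷ Ps ∷ʳ R) → ∀ {u v} → u ∈ verts P → v ∈ verts R →
    ∃[ xs ] Walk Arc u v xs × xs ↭ all (P ∷ Ps ∷ʳ R)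
  full-walk P Ps R chain u∈ v∈ = go Ps chain
    where
    2≤ : ∀ Ps → 2 ≤ length (all (P ∷ Ps))
    2≤ Ps = ≤-trans (≤-trans (len>1 P) (m≤m+n (len P) _)) (≤-reflexive (sym
      (trans (length-++ (verts P)) (cong (_+ length (all Ps)) (length-verts P)))))

    go : ∀ Ps → Chain (P ∷ Ps ∷ʳ R) → ∃[ xs ] Walk Arc _ _ xs × xs ↭ all (P ∷ Ps ∷ʳ R)
    go [] chain =
      let xs , walk , xs≲ , len≡ = chain-walk P R [] chain u∈ v∈ _ (2≤ (R ∷ [])) ≤-refl
      in xs , walk , ≲-full xs≲ len≡
    go (Q ∷ Qs) chain =
      let xs , walk , xs≲ , len≡ = chain-walk P Q (Qs ∷ʳ R) chain u∈
            (subst (λ Z → _ ∈ verts Z) (sym (lastRing-∷ʳ Q Qs R)) v∈) _ (2≤ (Q ∷ Qs ∷ʳ R)) ≤-refl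
      in xs , walk , ≲-full xs≲ len≡

  -- Inserting a ring into a chain

  dominates? : ∀ {xs ys} → Between Adjacent xs ys →
    Between Dominates xs ys ⊎ (∃₂ λ u v → u ∈ xs × v ∈ ys × Arc v u)
  dominates? {xs} {ys} xs∼ys with All.all? (λ u → All.all? (arc? u) ys) xs
  ... | yes arcs = inj₁ λ u∈ v∈ →
    let a = All.lookup (All.lookup arcs u∈) v∈ in a , not-both (xs∼ys u∈ v∈) a
  ... | no ¬arcs with find (All.¬All⇒Any¬ (λ u → All.all? (arc? u) ys) xs ¬arcs)
  ...   | u , u∈ , ¬row with find (All.¬All⇒Any¬ (arc? u) ys ¬row)
  ...     | v , v∈ , ¬a = inj₂ (u , v , u∈ , v∈ , backward (xs∼ys u∈ v∈) ¬a)

  mixed-intro : ∀ {X Y} → Between Adjacent (verts X) (verts Y) →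
    ∀ {u v u′ v′} → u ∈ verts X → v ∈ verts Y → Arc u v → u′ ∈ verts X → v′ ∈ verts Y → Arc v′ u′ →
    Mixed X Y
  mixed-intro {X} {Y} adjacent u∈ v∈ a u′∈ v′∈ b with index X u∈ | index Y v∈ | index X u′∈ | index Y v′∈
  ... | j , refl | i , refl | j′ , refl | i′ , refl =
    record { adjacent = adjacent ; forth = j , i , a ; back = j′ , i′ , b }

  -- The rings Ps are the part of the chain already known to be dominated by X.
  insert : ∀ X Ps Rs → Chain (X ∷ Ps) → Chain Rs → Between Dominates (all Ps) (all Rs) →
    Between Adjacent (verts X) (all Rs) →
    ∃[ Zs ] Chain Zs × all Zs ↭ verts X ++ all Ps ++ all Rs
  insert X Ps [] chain _ _ _ = X ∷ Ps , chain ,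
    ↭-++⁺ˡ (verts X) (↭-reflexive (sym (++-identityʳ (all Ps))))
  insert X Ps (R ∷ Rs) (X⇒Ps ∷ chain) (R⇒Rs ∷ chain′) Ps⇒ X∼
    with dominates? {verts X} {verts R} (λ u∈ v∈ → X∼ u∈ (∈-++⁺ˡ v∈))
  ... | inj₁ X⇒R =
    let Zs , chain″ , p = insert X (Ps ∷ʳ R) Rs
          ((λ u∈ v∈ → between-++ʳ X⇒Ps X⇒R u∈ (subst (_ ∈_) (all-∷ʳ Ps R) v∈)) ∷
            chain-∷ʳ chain (λ u∈ v∈ → Ps⇒ u∈ (∈-++⁺ˡ v∈)))
          chain′
          (λ u∈ v∈ → between-++ˡ (λ u∈ v∈ → Ps⇒ u∈ (∈-++⁺ʳ (verts R) v∈)) R⇒Rs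
            (subst (_ ∈_) (all-∷ʳ Ps R) u∈) v∈)
          (λ u∈ v∈ → X∼ u∈ (∈-++⁺ʳ (verts R) v∈))
    in Zs , chain″ , ↭-trans p (↭-++⁺ˡ (verts X) (↭-reflexive
         (trans (cong (_++ all Rs) (all-∷ʳ Ps R)) (++-assoc (all Ps) (verts R) (all Rs)))))
  insert X [] (R ∷ Rs) _ (R⇒Rs ∷ chain′) _ X∼ | inj₂ (x , r , x∈ , r∈ , r→x)
    with dominates? {verts R} {verts X} (λ u∈ v∈ → adjacent-sym (X∼ v∈ (∈-++⁺ˡ u∈)))
  -- R dominates X and all of `Rs`, so it can precede whatever chain these produce.
  ... | inj₁ R⇒X =
    let Zs , chain″ , p = insert X [] Rs ((λ _ ()) ∷ []) chain′ (λ ()) (λ u∈ v∈ → X∼ u∈ (∈-++⁺ʳ (verts R) v∈))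
    in R ∷ Zs , (λ u∈ v∈ → between-++ʳ R⇒X R⇒Rs u∈ (∈-resp-↭ p v∈)) ∷ chain″ ,
       ↭-trans (↭-++⁺ˡ (verts R) p) (shifts (verts R) (verts X))
  ... | inj₂ (r′ , x′ , r′∈ , x′∈ , x′→r′) =
    -- The merged ring is only known to be adjacent to `Rs`, so it has to be inserted anew.
    let Z , p = merge (mixed-intro {X} {R} (λ u∈ v∈ → X∼ u∈ (∈-++⁺ˡ v∈)) x′∈ r′∈ x′→r′ x∈ r∈ r→x)
        Zs , chain″ , q = insert Z [] Rs ((λ _ ()) ∷ []) chain′ (λ ())
          (λ u∈ v∈ → between-++ˡ {Adjacent} (λ u∈ v∈ → X∼ u∈ (∈-++⁺ʳ (verts R) v∈)) (λ u∈ v∈ → inj₁ (R⇒Rs u∈ v∈))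
            (∈-resp-↭ p u∈) v∈)
    in Zs , chain″ , ↭-trans q (↭-trans (↭-++⁺ʳ (all Rs) p) (↭-++-assoc (verts X) (verts R) (all Rs)))
  insert X (P ∷ Ps) (R ∷ Rs) (X⇒Ps ∷ chain) (R⇒Rs ∷ chain′) Ps⇒ X∼ | inj₂ (x , r , x∈ , r∈ , r→x)
    with index X x∈ | full-walk P Ps R middle (at∈ P 0) r∈
    where
    middle : Chain (P ∷ Ps ∷ʳ R)
    middle = chain-∷ʳ chain (λ u∈ v∈ → Ps⇒ u∈ (∈-++⁺ˡ v∈))
  ... | i , refl | xs , walk , p =
    -- One ring absorbs X, the whole prefix and R: once around X from `x`, through all of the prefix
    -- and R up to `r`, and back along `r → x`.
    let Z , q = ringOn (seg-walk X i (pred X) ++⟨ proj₁ (X⇒Ps (at∈ X _) (∈-++⁺ˡ (at∈ P 0))) ⟩ walk) r→x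
          (↭-++⁺ (rotate X i) p)
          (unique-++ (subst (λ ys → Between Adjacent (verts X) ys) (sym (all-∷ʳ (P ∷ Ps) R))
              (between-++ʳ {Adjacent} (λ u∈ v∈ → inj₁ (X⇒Ps u∈ v∈)) (λ u∈ v∈ → X∼ u∈ (∈-++⁺ˡ v∈))))
            (Ring.unique X)
            (ordered-unique (chain⇒ordered (chain-∷ʳ chain λ u∈ v∈ → Ps⇒ u∈ (∈-++⁺ˡ v∈)))))
        q′ = ↭-trans q (↭-++⁺ˡ (verts X) (↭-reflexive (all-∷ʳ (P ∷ Ps) R)))
        Zs , chain″ , p′ = insert Z [] Rs ((λ _ ()) ∷ []) chain′ (λ ())
          (λ u∈ v∈ → between-++ˡ {Adjacent} (λ u∈ v∈ → X∼ u∈ (∈-++⁺ʳ (verts R) v∈))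
            (between-++ˡ {Adjacent} (λ u∈ v∈ → inj₁ (Ps⇒ u∈ (∈-++⁺ʳ (verts R) v∈))) (λ u∈ v∈ → inj₁ (R⇒Rs u∈ v∈)))
            (∈-resp-↭ q′ u∈) v∈)
    in Zs , chain″ , (begin
      all Zs                                                ↭⟨ p′ ⟩
      verts Z ++ all Rs                                     ↭⟨ ↭-++⁺ʳ (all Rs) q′ ⟩
      (verts X ++ all (P ∷ Ps) ++ verts R) ++ all Rs        ↭⟨ ↭-++-assoc (verts X) _ (all Rs) ⟩
      verts X ++ (all (P ∷ Ps) ++ verts R) ++ all Rs        ↭⟨ ↭-++⁺ˡ (verts X) (↭-++-assoc (all (P ∷ Ps)) (verts R) (all Rs)) ⟩
      verts X ++ all (P ∷ Ps) ++ verts R ++ all Rs          ∎)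
    where open PermutationReasoning

  arrange : ∀ {Xs} → Ordered Adjacent Xs → ∃[ Zs ] Chain Zs × all Zs ↭ all Xs
  arrange [] = [] , [] , ↭-refl
  arrange {X ∷ Xs} (X∼ ∷ ordered) =
    let Zs , chain , p = arrange ordered
        Zs′ , chain′ , q = insert X [] Zs ((λ _ ()) ∷ []) chain (λ ()) (λ u∈ v∈ → X∼ u∈ (∈-resp-↭ p v∈))
    in Zs′ , chain′ , ↭-trans q (↭-++⁺ˡ (verts X) p)

  -- Strong connectivity

  -- A path from `u` to `w` has to pass from `P` to `Q`: at the first vertex that `split` assigns to
  -- `Q`, or at `w`.
  cross : Strong D → {P Q : Vertex D → Set} → (∀ v → P v ⊎ Q v) →
    ∀ {u w} → u ≢ w → P u → Q w → ∃₂ λ a b → Arc a b × P a × Q b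
  cross strong {P} {Q} split {u} {w} u≢w Pu Qw = go (Path.interior path) (Path.arcs path) Pu
    where
    path = proj₁ (strong u w u≢w)

    go : ∀ {u} xs → Linked Arc (u ∷ xs ∷ʳ w) → P u → ∃₂ λ a b → Arc a b × P a × Q b
    go []       (a ∷ _)     Pu = _ , _ , a , Pu , Qw
    go (x ∷ xs) (a ∷ steps) Pu with split x
    ... | inj₁ Px = go xs steps Px
    ... | inj₂ Qx = _ , _ , a , Pu , Qx

  ring⇒hamiltonian : (X : Ring Arc) → (∀ v → v ∈ verts X) → Hamiltonian D
  ring⇒hamiltonian X covers with closeCycle (seg-walk X 0 (pred X)) closing (Ring.unique X)
    where
    closing : Arc (at X (pred X + 0)) (at X 0)
    closing = subst (Arc _) (period X 0) (Ring.step X (pred X + 0))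
  ... | c , eq = c , λ v → subst (v ∈_) (sym eq) (covers v)

  -- With two or more members, strength gives an arc from a later ring into the first, against
  -- domination.
  chain⇒hamiltonian : Strong D → Vertex D → ∀ {Xs} → Chain Xs → (∀ v → v ∈ all Xs) → Hamiltonian D
  chain⇒hamiltonian strong v {[]} _ covers with covers v
  ... | ()
  chain⇒hamiltonian strong _ {X ∷ []} _ covers = ring⇒hamiltonian X λ v → ∈-resp-↭ (all-[-] X) (covers v)
  chain⇒hamiltonian strong _ {X ∷ Y ∷ Ys} (X⇒ ∷ _) covers
    with cross strong (λ v → Sum.swap (∈-++⁻ (verts X) (covers v)))
           (λ eq → loopless (sym eq) (proj₁ (X⇒ (at∈ X 0) (∈-++⁺ˡ (at∈ Y 0)))))
           (∈-++⁺ˡ (at∈ Y 0)) (at∈ X 0)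
  ... | a , b , a→b , a∈ , b∈ = contradiction a→b (proj₂ (X⇒ b∈ a∈))

  lastRing-⊆ : ∀ X Ys {z} → z ∈ verts (lastRing X Ys) → z ∈ all (X ∷ Ys)
  lastRing-⊆ X []       z∈ = ∈-++⁺ˡ z∈
  lastRing-⊆ X (Y ∷ Ys) z∈ = ∈-++⁺ʳ (verts X) (lastRing-⊆ Y Ys z∈)

  -- Lying outside the last ring is expressed as dominating it, which excludes arcs from the last
  -- ring to `v`.
  before-last : ∀ X Ys → Chain (X ∷ Ys) → ∀ {v} → v ∈ all (X ∷ Ys) →
    v ∈ verts (lastRing X Ys) ⊎ (∀ {z} → z ∈ verts (lastRing X Ys) → Dominates v z)
  before-last X []       _           v∈ = inj₁ (∈-resp-↭ (all-[-] X) v∈)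
  before-last X (Y ∷ Ys) (X⇒ ∷ chain) v∈ with ∈-++⁻ (verts X) v∈
  ... | inj₁ v∈X  = inj₂ λ z∈ → X⇒ v∈X (lastRing-⊆ Y Ys z∈)
  ... | inj₂ v∈Ys = before-last Y Ys chain v∈Ys

  -- Cycles through a fixed ring

  module _ (strong : Strong D) {M R : Ring Arc} {Rs : List (Ring Arc)}
    (chain : Chain (R ∷ Rs)) (M∼ : Between Adjacent (verts M) (all (R ∷ Rs)))
    (covers : ∀ v → v ∈ verts M ⊎ v ∈ all (R ∷ Rs)) where

    private
      L : Ring Arc
      L = lastRing R Rs

    -- Some arc enters R from outside; its tail is not in `Rs`, because R dominates `Rs`.
    enter : ∃₂ λ x y → Arc x y × x ∈ verts M × y ∈ verts R
    enter with cross strong {λ v → v ∈ verts M ⊎ v ∈ all Rs} {λ v → v ∈ verts R} split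
                 (λ eq → adjacent-irrefl (M∼ (at∈ M 0) (subst (_∈ all (R ∷ Rs)) (sym eq) (∈-++⁺ˡ (at∈ R 0)))))
                 (inj₁ (at∈ M 0)) (at∈ R 0)
      where
      split : ∀ v → (v ∈ verts M ⊎ v ∈ all Rs) ⊎ v ∈ verts R
      split v with covers v
      ... | inj₁ v∈M = inj₁ (inj₁ v∈M)
      ... | inj₂ v∈ with ∈-++⁻ (verts R) v∈
      ...   | inj₁ v∈R  = inj₂ v∈R
      ...   | inj₂ v∈Rs = inj₁ (inj₂ v∈Rs)
    ... | x , y , x→y , inj₁ x∈ , y∈ = x , y , x→y , x∈ , y∈
    ... | x , y , x→y , inj₂ x∈ , y∈ = contradiction x→y (proj₂ (ordered-head chain y∈ x∈))

    leave : ∃₂ λ z x → Arc z x × z ∈ verts L × x ∈ verts M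
    leave with cross strong {λ v → v ∈ verts L} {λ v → v ∈ verts M ⊎ (∀ {z} → z ∈ verts L → Dominates v z)} split
                 (λ eq → adjacent-irrefl (M∼ (at∈ M 0) (subst (_∈ all (R ∷ Rs)) eq (lastRing-⊆ R Rs (at∈ L 0)))))
                 (at∈ L 0) (inj₁ (at∈ M 0))
      where
      split : ∀ v → v ∈ verts L ⊎ (v ∈ verts M ⊎ (∀ {z} → z ∈ verts L → Dominates v z))
      split v with covers v
      ... | inj₁ v∈M = inj₂ (inj₁ v∈M)
      ... | inj₂ v∈ with before-last R Rs chain v∈
      ...   | inj₁ v∈L = inj₁ v∈L
      ...   | inj₂ dom = inj₂ (inj₂ dom)
    ... | z , x , z→x , z∈ , inj₁ x∈  = z , x , z→x , z∈ , x∈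
    ... | z , x , z→x , z∈ , inj₂ dom = contradiction z→x (proj₂ (dom z∈))

  cycles-through : Strong D → ∀ {M R Rs} → Chain (R ∷ Rs) → Between Adjacent (verts M) (all (R ∷ Rs)) →
    (∀ v → v ∈ verts M ⊎ v ∈ all (R ∷ Rs)) →
    ∀ l → 3 ≤ l → l ≤ suc (length (all (R ∷ Rs))) → HasCycleOfLength D l
  cycles-through strong {M} {R} {[]} chain M∼ covers l 3≤l l≤
    with enter strong {M} chain M∼ covers | leave strong {M} chain M∼ covers
  ... | x , y , x→y , x∈ , y∈ | z , x′ , z→x′ , z∈ , x′∈ =
    short-cycles (mixed-intro {M} {R} (λ u∈ v∈ → M∼ u∈ (∈-++⁺ˡ v∈)) x∈ y∈ x→y x′∈ z∈ z→x′) l 3≤l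
      (≤-trans l≤ (≤-reflexive (cong suc (trans (↭-length (all-[-] R)) (length-verts R)))))
  cycles-through strong {M} {R} {R′ ∷ Rs} chain M∼ covers l 3≤l l≤
    with enter strong {M} chain M∼ covers | leave strong {M} chain M∼ covers
  ... | x , y , x→y , x∈ , y∈ | z , x′ , z→x′ , z∈ , x′∈ with index M x∈ | index M x′∈
  ...   | j , refl | i , refl = dispatch (arc? (at M i) y) (l ≤? suc (len M))
    where
    -- The cycle takes `suc h` vertices of M, from `x′` on, and the other `l ∸ suc h` from the
    -- chain, which must be at least two.
    through : ∀ h → h < len M → Arc (at M (h + i)) y → 2 + suc h ≤ l → HasCycleOfLength D l
    through h h<len a 2+h≤l =
      let xs , walk , xs≲ , len≡ = chain-walk R R′ Rs chain y∈ z∈ (l ∸ suc h) (m+n≤o⇒m≤o∸n 2 2+h≤l)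
            (≤-trans (∸-monoʳ-≤ l (s≤s z≤n)) (∸-monoˡ-≤ 1 l≤))
      in close (seg-walk M i h ++⟨ a ⟩ walk) z→x′ (≲-++⁺ (seg-≲ M i h<len) xs≲)
           (unique-++ M∼ (Ring.unique M) (ordered-unique (chain⇒ordered chain)))
           (trans (length-++ (seg (at M) i (suc h))) (trans (cong₂ _+_ (length-seg (at M) i (suc h)) len≡)
             (m+[n∸m]≡n (≤-trans (m≤n+m (suc h) 2) 2+h≤l))))

    dispatch : Dec (Arc (at M i) y) → Dec (l ≤ suc (len M)) → HasCycleOfLength D l
    -- With `x′ → y` present, one vertex of M suffices for every length.
    dispatch (yes a) _         = through 0 (s≤s z≤n) a 3≤l
    -- Otherwise `y → x′` is an arc, and with `x → y` it makes R and M mixed.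
    dispatch (no ¬a) (yes l≤M) =
      short-cycles (mixed-intro {R} {M} (λ u∈ v∈ → adjacent-sym (M∼ v∈ (∈-++⁺ˡ u∈)))
        y∈ x′∈ (backward (M∼ x′∈ (∈-++⁺ˡ y∈)) ¬a) y∈ x∈ x→y) l 3≤l l≤M
    -- Going along M from `x′` to `x` takes at most `len M` vertices, so at least two are left for
    -- the chain.
    dispatch (no _) (no l≰M) with Ring.reach M i j
    ... | h , h<len , eq = through h h<len (subst (λ u → Arc u y) (sym eq) x→y)
      (≤-trans (s≤s (s≤s h<len)) (≰⇒> l≰M))

-- Subsets omitting one index

total : ∀ {k} → (Fin k → ℕ) → ℕ
total n = Vec.sum (Vec.tabulate n)

sumOver-⊤ : ∀ {k} (n : Fin k → ℕ) → sumOver ⊤ n ≡ total n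
sumOver-⊤ {zero}  n = refl
sumOver-⊤ {suc k} n = cong (n Fin.zero +_) (sumOver-⊤ (n ∘ Fin.suc))

omit : ∀ {k} (n : Fin (suc k) → ℕ) i → ∃[ S ] ∣ S ∣ ≡ k × sumOver S n + n i ≡ total n
omit {k} n Fin.zero = outside ∷ ⊤ , ∣⊤∣≡n k ,
  trans (+-comm (sumOver ⊤ (n ∘ Fin.suc)) (n Fin.zero)) (cong (n Fin.zero +_) (sumOver-⊤ (n ∘ Fin.suc)))
omit {suc k} n (Fin.suc i) with omit (n ∘ Fin.suc) i
... | S , ∣S∣≡ , eq = inside ∷ S , cong suc ∣S∣≡ ,
  trans (+-assoc (n Fin.zero) (sumOver S (n ∘ Fin.suc)) (n (Fin.suc i))) (cong (n Fin.zero +_) eq)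

-- Once an index is left out, the cardinality forces all later ones to be included.
omitted : ∀ {k} (n : Fin (suc k) → ℕ) S → ∣ S ∣ ≡ k → ∃[ i ] sumOver S n + n i ≡ total n
omitted n (outside ∷ S) ∣S∣≡ with refl ← ∣p∣≡n⇒p≡⊤ {p = S} ∣S∣≡ = Fin.zero ,
  trans (+-comm (sumOver ⊤ (n ∘ Fin.suc)) (n Fin.zero)) (cong (n Fin.zero +_) (sumOver-⊤ (n ∘ Fin.suc)))
omitted {suc k} n (inside ∷ S) ∣S∣≡ with omitted (n ∘ Fin.suc) S (suc-injective ∣S∣≡)
... | i , eq = Fin.suc i ,
  trans (+-assoc (n Fin.zero) (sumOver S (n ∘ Fin.suc)) (n (Fin.suc i))) (cong (n Fin.zero +_) eq)

minimum : ∀ {k} (n : Fin (suc k) → ℕ) → ∃[ i ] ∀ j → n i ≤ n j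
minimum {zero}  n = Fin.zero , λ { Fin.zero → ≤-refl }
minimum {suc k} n with minimum (n ∘ Fin.suc)
... | i , least with ≤-total (n Fin.zero) (n (Fin.suc i))
...   | inj₁ 0≤i = Fin.zero , λ { Fin.zero → ≤-refl ; (Fin.suc j) → ≤-trans 0≤i (least j) }
...   | inj₂ i≤0 = Fin.suc i , λ { Fin.zero → i≤0 ; (Fin.suc j) → least j }

sum-allFin : ∀ {k} (n : Fin k → ℕ) → sum (map n (allFin k)) ≡ total n
sum-allFin n = trans (cong sum (map-tabulate id n)) (go n)
  where
  go : ∀ {k} (n : Fin k → ℕ) → sum (tabulate n) ≡ total n
  go {zero}  n = refl
  go {suc k} n = cong (n Fin.zero +_) (go (n ∘ Fin.suc))

-- The rings of a generalized sum

linked⇒walk : ∀ {V : Set} {Arc : Rel V 0ℓ} u xs {w} → Linked Arc (u ∷ xs ∷ʳ w) →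
  ∃[ v ] Walk Arc u v (u ∷ xs) × Arc v w
linked⇒walk u []       (a ∷ _) = u , end , a
linked⇒walk u (x ∷ xs) (a ∷ l) =
  let v , p , b = linked⇒walk x xs l in v , a ∷ p , b

-- A duplicate-free list of all vertices is a permutation of `allFin`.
hamiltonian-length : ∀ {D} (c : Cycle D) → (∀ v → v ∈ Cycle.vertices {D} c) →
  length (Cycle.vertices {D} c) ≡ order D
hamiltonian-length {D} c covers = trans
  (↭-length (∼bag⇒↭ (unique∧set⇒bag (Cycle.distinct {D} c) (Unique.allFin⁺ (order D))
    (mk⇔ (λ _ → ∈-allFin _) (λ _ → covers _)))))
  (length-tabulate id)

module _ {k : ℕ} {Ds : Fin k → Digraph} (hamiltonian : ∀ i → Hamiltonian (Ds i))
  {D : Digraph} (D∈⊕Ds : D ∈⊕ Ds) where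
  open _∈⊕_ D∈⊕Ds
  open Digraph D using (Arc)

  private
    cycle : ∀ i → Cycle (Ds i)
    cycle i = proj₁ (hamiltonian i)

    verticesOf : ∀ i → List (Vertex (Ds i))
    verticesOf i = Cycle.vertices {Ds i} (cycle i)

    embed-injective : ∀ i {u v} → embed i u ≡ embed i v → u ≡ v
    embed-injective i eq with Injection.injective (Inverse⇒Injection union) eq
    ... | refl = refl

    ringOf : ∀ i → ∃[ X ] verts {Arc = Arc} X ≡ map (embed i) (verticesOf i)
    ringOf i with linked⇒walk _ _ (Cycle.arcs {Ds i} (cycle i))
    ... | v , p , a = closeRing (map-walk (embed i) hom p) (hom a)
      (Unique.map⁺ (embed-injective i) (Cycle.distinct {Ds i} (cycle i)))
      where
      hom : ∀ {u v} → Digraph.Arc (Ds i) u v → Arc (embed i u) (embed i v)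
      hom = Equivalence.from (induced i _ _)

  ring : Fin k → Ring Arc
  ring i = proj₁ (ringOf i)

  length-ring : ∀ i → length (verts (ring i)) ≡ order (Ds i)
  length-ring i = trans (cong length (proj₂ (ringOf i)))
    (trans (length-map (embed i) (verticesOf i)) (hamiltonian-length {Ds i} (cycle i) (proj₂ (hamiltonian i))))

  ring-covers : ∀ v → ∃[ i ] v ∈ verts (ring i)
  ring-covers v with Inverse.from union v | Inverse.strictlyInverseˡ union v
  ... | i , u | refl = i , subst (embed i u ∈_) (sym (proj₂ (ringOf i))) (∈-map⁺ (embed i) (proj₂ (hamiltonian i) u))

  ∈-ring⁻ : ∀ i {v} → v ∈ verts (ring i) → ∃[ u ] v ≡ embed i u
  ∈-ring⁻ i {v} v∈ =
    let u , _ , eq = ∈-map⁻ (embed i) (subst (v ∈_) (proj₂ (ringOf i)) v∈) in u , eq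

  rings-adjacent : ∀ {i j} → i ≢ j → Between (Adjacent D) (verts (ring i)) (verts (ring j))
  rings-adjacent {i} {j} i≢j u∈ v∈ with ∈-ring⁻ i u∈ | ∈-ring⁻ j v∈
  ... | u , refl | v , refl = between i≢j u v

  rings : List (Fin k) → List (Ring Arc)
  rings = map ring

  ∈-rings⁻ : ∀ is {v} → v ∈ all D (rings is) → ∃[ i ] i ∈ is × v ∈ verts (ring i)
  ∈-rings⁻ (i ∷ is) v∈ with ∈-++⁻ (verts (ring i)) v∈
  ... | inj₁ v∈i = i , here refl , v∈i
  ... | inj₂ v∈is = let j , j∈ , v∈j = ∈-rings⁻ is v∈is in j , there j∈ , v∈j

  ∈-rings⁺ : ∀ {is i v} → i ∈ is → v ∈ verts (ring i) → v ∈ all D (rings is)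
  ∈-rings⁺ (here refl)          v∈ = ∈-++⁺ˡ v∈
  ∈-rings⁺ (there {x = j} i∈) v∈ = ∈-++⁺ʳ (verts (ring j)) (∈-rings⁺ i∈ v∈)

  rings-ordered : ∀ {is} → Unique is → Ordered D (Adjacent D) (rings is)
  rings-ordered []           = []
  rings-ordered (_∷_ {i} {is} i∉ uniq) =
    (λ u∈ v∈ → let j , j∈ , v∈j = ∈-rings⁻ is v∈ in rings-adjacent (All.lookup i∉ j∈) u∈ v∈j) ∷
    rings-ordered uniq

  length-rings : ∀ is → length (all D (rings is)) ≡ sum (map (order ∘ Ds) is)
  length-rings []       = refl
  length-rings (i ∷ is) = trans (length-++ (verts (ring i))) (cong₂ _+_ (length-ring i) (length-rings is))

  module _ (strong : Strong D) {i j : Fin k} {js} (split : allFin k ↭ i ∷ j ∷ js) where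

    private
      uniq : Unique (i ∷ j ∷ js)
      uniq = Unique-resp-↭ (setoid _) (↭⇒↭ₛ split) (Unique.allFin⁺ k)

      covers : ∀ v → v ∈ all D (rings (i ∷ j ∷ js))
      covers v = let h , v∈ = ring-covers v in ∈-rings⁺ (∈-resp-↭ split (∈-allFin h)) v∈

    sum-hamiltonian : Hamiltonian D
    sum-hamiltonian =
      let Zs , chain , p = arrange D (rings-ordered uniq)
      in chain⇒hamiltonian D strong (Ring.at (ring i) 0) chain λ v → ∈-resp-↭ (↭-sym p) (covers v)

    sum-cycles : ∀ l → 3 ≤ l → l ≤ suc (sum (map (order ∘ Ds) (j ∷ js))) → HasCycleOfLength D l
    sum-cycles l 3≤l l≤ with rings-ordered uniq
    ... | i∼ ∷ ordered with arrange D ordered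
    -- The ring of `j` contributes vertices, so the chain of the remaining rings is nonempty.
    ...   | [] , _ , p = contradiction (↭-length p) λ ()
    ...   | R ∷ Rs , chain , p =
      cycles-through D strong {ring i} chain (λ u∈ v∈ → i∼ u∈ (∈-resp-↭ p v∈)) covers′ l 3≤l
        (≤-trans l≤ (≤-reflexive (cong suc (trans (sym (length-rings (j ∷ js))) (sym (↭-length p))))))
      where
      covers′ : ∀ v → v ∈ verts (ring i) ⊎ v ∈ all D (R ∷ Rs)
      covers′ v with ∈-++⁻ (verts (ring i)) (covers v)
      ... | inj₁ v∈ = inj₁ v∈
      ... | inj₂ v∈ = inj₂ (∈-resp-↭ (↭-sym p) v∈)

-- Assertion (iii), with a smallest summand as the fixed ring

theorem35 : (k : ℕ) → 2 ≤ k →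
    (Ds : Fin k → Digraph) → (∀ i → Hamiltonian (Ds i)) →
    (D : Digraph) → D ∈⊕ Ds → Strong D →
    VertexPancyclic D
    ⊎ Pancyclic D
    ⊎ (Hamiltonian D ×
    (∃[ m ] m IsMaximumOf (λ x → ∃[ S ] ∣ S ∣ ≡ k ∸ 1 × x ≡ sumOver S (λ i → order (Ds i)) + 1)
    × (∀ l → 3 ≤ l → l ≤ m → HasCycleOfLength D l)))
theorem35 (suc (suc k)) (s≤s (s≤s z≤n)) Ds hamiltonian D D∈⊕Ds strong
  -- Omitting a summand of least order attains the maximum in (iii), so its ring is the one kept
  -- apart from the chain.
  with minimum (order ∘ Ds)
... | i , least with omit (order ∘ Ds) i | split-at i
  where
  split-at : ∀ i → ∃₂ λ j js → allFin (2 + k) ↭ i ∷ j ∷ js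
  split-at i with ∈-∃++ (∈-allFin i)
  ... | xs , ys , eq with xs ++ ys | ↭-trans (↭-reflexive eq) (↭-shift i xs ys)
  ...   | []     | p = contradiction (↭-length p) λ ()
  ...   | j ∷ js | p = j , js , p
... | S , ∣S∣≡ , S+i≡ | j , js , p =
  inj₂ (inj₂ (sum-hamiltonian hamiltonian D∈⊕Ds strong p ,
    sumOver S n + 1 , ((S , ∣S∣≡ , refl) , maximal) ,
    λ l 3≤l l≤ → sum-cycles hamiltonian D∈⊕Ds strong p l 3≤l (≤-trans l≤ (≤-reflexive bound))))
  where
  n : Fin (2 + k) → ℕ
  n = order ∘ Ds

  maximal : ∀ x → (∃[ S ] ∣ S ∣ ≡ suc k × x ≡ sumOver S n + 1) → x ≤ sumOver S n + 1
  maximal _ (S′ , ∣S′∣≡ , refl) with omitted n S′ ∣S′∣≡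
  ... | i′ , S′+i′≡ = +-monoˡ-≤ 1 (+-cancelʳ-≤ (n i′) (sumOver S′ n) (sumOver S n)
    (≤-trans (≤-reflexive (trans S′+i′≡ (sym S+i≡))) (+-monoʳ-≤ (sumOver S n) (least i′))))

  bound : sumOver S n + 1 ≡ suc (sum (map n (j ∷ js)))
  bound = trans (+-comm (sumOver S n) 1) (cong suc (+-cancelʳ-≡ (n i) (sumOver S n) (sum (map n (j ∷ js)))
    (trans S+i≡ (trans (sym (sum-allFin n)) (trans (sum-↭ (↭-map⁺ n p)) (+-comm (n i) (sum (map n (j ∷ js)))))))))
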